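{- Let $k$ and $r$ be positive integers with $r\ge 2$ and $k\le r$, and let $G$ be a graph with $\chi(G)\le r$. Let $P\subset V(G)$ and let $d\colon P\to[r+k]$ be a precoloring of $P$ in $G$. (1) If $r+k\equiv 0\pmod 2$ and $|\mathcal{D}_G(P,2)|<2(r+k-1)$, then $d$ can be extended to a $\frac{3r+k}{2}$-coloring of $G$. (2) If $r+k\equiv 1\pmod 2$, $r+k\ge 13$ and $|\mathcal{D}_G(P,2)|<3(r+k-1)$, then $d$ can be extended to a $\frac{3r+k+1}{2}$-coloring of $G$.
   Context: For a graph $G$, $P\subset V(G)$ and a positive integer $k$, $\mathcal{D}_G(P,k)=\{\{x,y\}\subset P: x\ne y,\ d_G(x,y)\le k\}$, where $d_G$ is the distance in $G$. $[m]=\{1,\dots,m\}$. A precoloring of $P$ in $G$ is a proper coloring of $G[P]$; an $m$-coloring of $G$ is a proper coloring using at most $m$ colors; $d$ is extended by a coloring $f$ of $G$ if $f(v)=d(v)$ for all $v\in P$. -}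

module Defs where

open import Data.Fin using (Fin; toℕ)
open import Data.Fin.Subset using (Subset; ⁅_⁆; _∪_) renaming (_∈_ to _∈ˢ_)
open import Data.List using (List; length)
open import Data.List.Membership.Propositional using (_∈_)
open import Data.List.Relation.Unary.Unique.Propositional using (Unique)
open import Data.Nat using (ℕ; zero; suc; _≤_)
open import Data.Product using (∃; ∃₂; ∃-syntax; _×_; _,_; proj₁)
open import Function.Bundles using (_⇔_)
open import Level using (0ℓ)
open import Relation.Binary using (Rel; Decidable; Symmetric)
open import Relation.Binary.PropositionalEquality using (_≡_; _≢_)
open import Relation.Nullary using (¬_)
open import Relation.Unary using (Pred)

-- Simple graphs; a finite graph is a Graph (Fin n).
record Graph (V : Set) : Set₁ where
  field
    Adj    : Rel V 0ℓ
    Adj?   : Decidable Adj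
    sym    : Symmetric Adj
    irrefl : ∀ {v} → ¬ Adj v v

open Graph public

induced : ∀ {n} → Graph (Fin n) → (P : Subset n) → Graph (∃ (_∈ˢ P))
induced G P = record
  { Adj    = λ u v → Adj G (proj₁ u) (proj₁ v)
  ; Adj?   = λ u v → Adj? G (proj₁ u) (proj₁ v)
  ; sym    = sym G
  ; irrefl = irrefl G
  }

IsProper : {V C : Set} → Graph V → (V → C) → Set
IsProper G f = ∀ u v → Adj G u v → f u ≢ f v

-- The palette [m] is Fin m: colour i + 1 is the element with toℕ equal to i.
IsColoring : {V : Set} (m : ℕ) → Graph V → (V → Fin m) → Set
IsColoring m G f = IsProper G f

Colorable : {V : Set} → Graph V → ℕ → Set
Colorable {V} G m = ∃[ f ] IsColoring {V} m G f

IsChromaticNumber : {V : Set} → Graph V → ℕ → Set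
IsChromaticNumber G c = Colorable G c × (∀ m → Colorable G m → c ≤ m)

IsPrecoloring : ∀ {n m} → Graph (Fin n) → (P : Subset n) → (∃ (_∈ˢ P) → Fin m) → Set
IsPrecoloring G P d = IsProper (induced G P) d

-- The two palettes may differ in size and are compared as initial segments
-- of ℕ, so that [m] ⊆ [m′] for m ≤ m′.
Extends : ∀ {n m m′} (P : Subset n) → (∃ (_∈ˢ P) → Fin m) → (Fin n → Fin m′) → Set
Extends P d f = ∀ v (v∈P : v ∈ˢ P) → toℕ (f v) ≡ toℕ (d (v , v∈P))

ExtendsToColoring : ∀ {n m} → Graph (Fin n) → (P : Subset n) → (∃ (_∈ˢ P) → Fin m) → ℕ → Set
ExtendsToColoring G P d m′ = ∃[ f ] (IsColoring m′ G f × Extends P d f)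

data Walk {V : Set} (G : Graph V) : ℕ → V → V → Set where
  []  : ∀ {x} → Walk G zero x x
  _∷_ : ∀ {l x y z} → Adj G x y → Walk G l y z → Walk G (suc l) x z

IsDistance : {V : Set} → Graph V → V → V → ℕ → Set
IsDistance G x y l = Walk G l x y × (∀ l′ → Walk G l′ x y → l ≤ l′)

-- Vertices in different components have no distance, i.e. distance ∞.
DistanceAtMost : {V : Set} → Graph V → ℕ → V → V → Set
DistanceAtMost G k x y = ∃[ l ] (IsDistance G x y l × l ≤ k)

-- A set of two-element vertex sets: each {x, y} occurs once, as a Subset.
𝒟 : ∀ {n} → Graph (Fin n) → Subset n → ℕ → Pred (Subset n) 0ℓ
𝒟 G P k S = ∃₂ λ x y →
  S ≡ ⁅ x ⁆ ∪ ⁅ y ⁆ × x ∈ˢ P × y ∈ˢ P × x ≢ y × DistanceAtMost G k x y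

HasCardinality : {A : Set} → Pred A 0ℓ → ℕ → Set
HasCardinality {A} Q c =
  ∃[ xs ] (Unique {A = A} xs × (∀ a → (a ∈ xs) ⇔ Q a) × length xs ≡ c)

{-# OPTIONS --safe #-}
module Submission where

open import Data.Empty using (⊥)
open import Data.Fin using (Fin; zero; suc; toℕ; fromℕ<; inject≤)
open import Data.Fin.Permutation using (transpose; _⟨$⟩ʳ_)
open import Data.Fin.Permutation.Components using (transpose-inverse)
import Data.Fin.Properties as Fin
open import Data.Fin.Subset using (Subset; _∈_; _∉_; ⁅_⁆; _∪_)
open import Data.Fin.Subset.Properties using (_∈?_; x∈⁅x⁆; x∈⁅y⁆⇒x≡y; x∈p∪q⁺; x∈p∪q⁻)
open import Data.List using (List; []; _∷_; _++_; length; map; upTo)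
open import Data.List.Membership.Propositional using () renaming (_∈_ to _∈ˡ_)
open import Data.List.Properties using (map-++; length-++; length-map; ++-identityʳ; ++-assoc; length-upTo; upTo-∷ʳ)
open import Data.List.Relation.Binary.Permutation.Propositional using (_↭_; refl; prep; swap; trans; ↭-sym; ↭-reflexive; ↭⇒↭ₛ)
open import Data.List.Relation.Binary.Permutation.Propositional.Properties using (map⁺; ++⁺; ++⁺ˡ; ++⁺ʳ; ↭-length; shifts; All-resp-↭; ∈-resp-↭; ∷↭∷ʳ)
import Data.List.Relation.Binary.Permutation.Setoid.Properties as Permutationₛ
open import Data.List.Relation.Unary.All as All using (All; []; _∷_)
import Data.List.Relation.Unary.All.Properties as All
open import Data.List.Relation.Unary.AllPairs as AllPairs using (AllPairs; []; _∷_)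
open import Data.List.Relation.Unary.Any using (here; there)
open import Data.List.Relation.Unary.Unique.Propositional using (Unique)
open import Data.List.Relation.Unary.Unique.Propositional.Properties using (upTo⁺)
open import Data.Nat using (ℕ; zero; suc; _+_; _*_; _∸_; _≤_; _<_; _≥_; z≤n; s≤s; _≤?_; _≟_)
open import Data.Nat.DivMod using (_/_; _%_; m≡m%n+[m/n]*n; m*n/n≡m)
open import Data.Nat.ListAction using (sum)
open import Data.Nat.ListAction.Properties using (sum-↭; sum-++)
open import Data.Nat.Properties hiding (_≟_; _≤?_)
open import Data.Nat.Tactic.RingSolver using (solve-∀)
open import Data.Product as Product using (∃; ∃₂; _×_; _,_; proj₁; proj₂)
open import Data.Sum using (_⊎_; inj₁; inj₂; [_,_]′)
open import Data.Vec.Properties.WithK using ([]=-irrelevant)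
open import Function using (_∘_)
open import Function.Bundles using (Equivalence)
open import Relation.Binary using (Symmetric)
open import Relation.Binary.PropositionalEquality as ≡ using (_≡_; _≢_; cong; cong₂; subst; ≢-sym)
open import Relation.Nullary using (yes; no; contradiction; _×-dec_)
open import Defs

-- Let s = r + k. Group the s colours into pairs (for s odd, after adding one new
-- colour) and hand each class of an r-colouring either a pair or one further new
-- colour; this uses the allowed number of colours. A vertex outside P can then be
-- coloured from its class's pair {a , b} unless it sees both a and b on P, in which
-- case two vertices of P coloured a and b are at distance at most 2. Weight the
-- pairs of colours by the number of such vertex pairs. If the chosen matching of
-- the colours has total weight at most 1, the only conflict, caused by x and y, is
-- harmless when its pair of colours goes to the class of x, which contains no
-- neighbour of x. Such a matching exists: take a weight-0 matching that cannot be
-- augmented along short paths; if it leaves too many colours uncovered, the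
-- absence of augmenting paths forces the total weight up to 2(s - 1), respectively
-- 3(s - 1).

private variable
  A : Set

-- Sums over lists

+-interchange : ∀ a b c d → a + b + (c + d) ≡ a + c + (b + d)
+-interchange = solve-∀

∑ : (A → ℕ) → List A → ℕ
∑ f xs = sum (map f xs)

∑-↭ : (f : A → ℕ) {xs ys : List A} → xs ↭ ys → ∑ f xs ≡ ∑ f ys
∑-↭ f p = sum-↭ (map⁺ f p)

∑-++ : (f : A → ℕ) (xs ys : List A) → ∑ f (xs ++ ys) ≡ ∑ f xs + ∑ f ys
∑-++ f xs ys = ≡.trans (cong sum (map-++ f xs ys)) (sum-++ (map f xs) (map f ys))

∑-++-≥ʳ : ∀ (f : A → ℕ) xs ys → ∑ f ys ≤ ∑ f (xs ++ ys)
∑-++-≥ʳ f xs ys = ≤-trans (m≤n+m (∑ f ys) (∑ f xs)) (≤-reflexive (≡.sym (∑-++ f xs ys)))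

∑-+ : (f g : A → ℕ) (xs : List A) → ∑ (λ x → f x + g x) xs ≡ ∑ f xs + ∑ g xs
∑-+ f g []       = ≡.refl
∑-+ f g (x ∷ xs) rewrite ∑-+ f g xs = +-interchange (f x) (g x) (∑ f xs) (∑ g xs)

∑-≥ : ∀ (f : A → ℕ) t {xs} → All (λ x → t ≤ f x) xs → length xs * t ≤ ∑ f xs
∑-≥ f t []        = z≤n
∑-≥ f t (p ∷ ps) = +-mono-≤ p (∑-≥ f t ps)

-- At most one entry can lie below `t`. If it is the head, it is grouped with the next entry and all
-- others reach `t`; a head that reaches `t` is peeled off, down to a list of two.
∑-≥-average : ∀ (h : A → ℕ) t {x y xs} →
  AllPairs (λ u v → t + t ≤ h u + h v) (x ∷ y ∷ xs) →
  length (x ∷ y ∷ xs) * t ≤ ∑ h (x ∷ y ∷ xs)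
∑-≥-average h t {x} {y} {xs} ((xy ∷ xzs) ∷ rest) with t ≤? h x
∑-≥-average h t {x} {y} {[]} ((xy ∷ []) ∷ rest) | yes _ = begin
  t + (t + 0)       ≡⟨ lemma t t ⟩
  t + t             ≤⟨ xy ⟩
  h x + h y         ≡⟨ lemma (h x) (h y) ⟨
  h x + (h y + 0)   ∎
  where
  open ≤-Reasoning
  lemma : ∀ a b → a + (b + 0) ≡ a + b
  lemma = solve-∀
∑-≥-average h t {x} {y} {z ∷ zs} (_ ∷ rest) | yes t≤hx =
  +-mono-≤ t≤hx (∑-≥-average h t rest)
... | no t≰hx = begin
  t + (t + length xs * t)       ≡⟨ +-assoc t t _ ⟨
  t + t + length xs * t         ≤⟨ +-mono-≤ xy (∑-≥ h t (All.map large xzs)) ⟩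
  h x + h y + ∑ h xs            ≡⟨ +-assoc (h x) (h y) _ ⟩
  h x + (h y + ∑ h xs)          ∎
  where
  open ≤-Reasoning
  large : ∀ {z} → t + t ≤ h x + h z → t ≤ h z
  large {z} le = +-cancelˡ-≤ t t (h z) (≤-trans le (+-monoˡ-≤ (h z) (<⇒≤ (≰⇒> t≰hx))))

pairSum : (A → A → ℕ) → List A → ℕ
pairSum w []       = 0
pairSum w (x ∷ xs) = ∑ (w x) xs + pairSum w xs

pairSum-+ : (f g : A → A → ℕ) (xs : List A) →
  pairSum (λ x y → f x y + g x y) xs ≡ pairSum f xs + pairSum g xs
pairSum-+ f g []       = ≡.refl
pairSum-+ f g (x ∷ xs) rewrite ∑-+ (f x) (g x) xs | pairSum-+ f g xs =
  +-interchange (∑ (f x) xs) (∑ (g x) xs) (pairSum f xs) (pairSum g xs)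

-- The binomial coefficient `n` choose 2, which counts the pairs among `n` vertices.
triangular : ℕ → ℕ
triangular zero    = 0
triangular (suc n) = n + triangular n

flatten : List (A × A) → List A
flatten []             = []
flatten ((p , q) ∷ ps) = p ∷ q ∷ flatten ps

length-flatten : (ps : List (A × A)) → length (flatten ps) ≡ length ps * 2
length-flatten []       = ≡.refl
length-flatten (_ ∷ ps) = cong (λ n → suc (suc n)) (length-flatten ps)

flatten-++ : (ps qs : List (A × A)) → flatten (ps ++ qs) ≡ flatten ps ++ flatten qs
flatten-++ []             qs = ≡.refl
flatten-++ ((p , q) ∷ ps) qs = cong (λ xs → p ∷ q ∷ xs) (flatten-++ ps qs)

flatten-↭ : {ps qs : List (A × A)} → ps ↭ qs → flatten ps ↭ flatten qs
flatten-↭ refl                 = refl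
flatten-↭ (prep (p , q) σ)     = prep p (prep q (flatten-↭ σ))
flatten-↭ (swap (a , b) (c , d) σ) =
  trans (shifts (a ∷ b ∷ []) (c ∷ d ∷ [])) (++⁺ˡ (c ∷ d ∷ a ∷ b ∷ []) (flatten-↭ σ))
flatten-↭ (trans σ τ)          = trans (flatten-↭ σ) (flatten-↭ τ)

AllPairs-resp-↭ : {R : A → A → Set} → Symmetric R → {xs ys : List A} →
  xs ↭ ys → AllPairs R xs → AllPairs R ys
AllPairs-resp-↭ {A = A} {R} R-sym σ =
  Permutationₛ.AllPairs-resp-↭ (≡.setoid A) R-sym
    (≡.subst (R _) , ≡.subst (λ x → R x _)) (↭⇒↭ₛ σ)

all-or-pick : {Q R : A → Set} → (∀ x → Q x ⊎ R x) → ∀ xs →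
  (∃₂ λ x xs′ → xs ↭ x ∷ xs′ × Q x) ⊎ All R xs
all-or-pick dec []       = inj₂ []
all-or-pick dec (x ∷ xs) with dec x
... | inj₁ q = inj₁ (x , xs , refl , q)
... | inj₂ r with all-or-pick dec xs
...   | inj₁ (y , ys , σ , q) = inj₁ (y , x ∷ ys , trans (prep x σ) (swap x y refl) , q)
...   | inj₂ rs               = inj₂ (r ∷ rs)

allPairs-or-pick : {Q R : A → A → Set} → (∀ x y → Q x y ⊎ R x y) → ∀ xs →
  (∃₂ λ x y → ∃ λ xs′ → xs ↭ x ∷ y ∷ xs′ × Q x y) ⊎ AllPairs R xs
allPairs-or-pick dec []       = inj₂ []
allPairs-or-pick dec (x ∷ xs) with all-or-pick (dec x) xs
... | inj₁ (y , ys , σ , q) = inj₁ (x , y , ys , prep x σ , q)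
... | inj₂ rs with allPairs-or-pick dec xs
...   | inj₂ rss = inj₂ (rs ∷ rss)
...   | inj₁ (y , z , zs , σ , q) =
  inj₁ (y , z , x ∷ zs , trans (prep x σ) (shifts (x ∷ []) (y ∷ z ∷ [])) , q)

-- Matchings of small weight

2*triangular : ∀ n → 2 * triangular (suc n) ≡ suc n * n
2*triangular zero    = ≡.refl
2*triangular (suc n) = begin
  2 * (suc n + triangular (suc n))      ≡⟨ *-distribˡ-+ 2 (suc n) _ ⟩
  2 * suc n + 2 * triangular (suc n)    ≡⟨ cong (2 * suc n +_) (2*triangular n) ⟩
  2 * suc n + suc n * n                 ≡⟨ lemma n ⟩
  suc (suc n) * suc n                   ∎
  where
  open ≡.≡-Reasoning
  lemma : ∀ n → 2 * (1 + n) + (1 + n) * n ≡ (2 + n) * (1 + n)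
  lemma = solve-∀

-- For `f = w p` and `g = w q`, a failure at `u` and `v` is an augmenting path u p q v or v p q u:
-- its two new pairs cost less than `t` together.
Crossing : ℕ → (A → ℕ) → (A → ℕ) → List A → Set
Crossing t f g = AllPairs (λ u v → t ≤ f u + g v × t ≤ f v + g u)

crossing-or-pick : ∀ t (f g : A → ℕ) xs →
  (∃₂ λ u v → ∃ λ xs′ → xs ↭ u ∷ v ∷ xs′ × f u + g v < t) ⊎ Crossing t f g xs
crossing-or-pick t f g xs with allPairs-or-pick split xs
  where
  split : ∀ u v → (f u + g v < t ⊎ f v + g u < t) ⊎ (t ≤ f u + g v × t ≤ f v + g u)
  split u v with <-≤-connex (f u + g v) t | <-≤-connex (f v + g u) t
  ... | inj₁ p | _      = inj₁ (inj₁ p)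
  ... | inj₂ _ | inj₁ p = inj₁ (inj₂ p)
  ... | inj₂ p | inj₂ q = inj₂ (p , q)
... | inj₁ (u , v , xs′ , σ , inj₁ p) = inj₁ (u , v , xs′ , σ , p)
... | inj₁ (u , v , xs′ , σ , inj₂ p) = inj₁ (v , u , xs′ , trans σ (swap u v refl) , p)
... | inj₂ c                          = inj₂ c

crossing-swap : ∀ {t} (f g : A → ℕ) {xs} → Crossing t f g xs → Crossing t g f xs
crossing-swap {t = t} f g = AllPairs.map λ {u} {v} (p , q) →
  subst (t ≤_) (+-comm (f v) (g u)) q , subst (t ≤_) (+-comm (f u) (g v)) p

-- Adding the two inequalities for `u` and `v` bounds the values of `f + g` there by `t + t` in
-- total, so averaging applies.
crossing-∑ : ∀ t (f g : A → ℕ) {xs} → 2 ≤ length xs → Crossing t f g xs →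
  length xs * t ≤ ∑ f xs + ∑ g xs
crossing-∑ t f g {_ ∷ []} (s≤s ()) c
crossing-∑ t f g {x ∷ y ∷ xs} _ c =
  ≤-trans (∑-≥-average (λ u → f u + g u) t (AllPairs.map combine c))
    (≤-reflexive (∑-+ f g (x ∷ y ∷ xs)))
  where
  rearrange : ∀ a b c d → a + b + (c + d) ≡ (a + d) + (c + b)
  rearrange = solve-∀
  combine : ∀ {u v} → t ≤ f u + g v × t ≤ f v + g u → t + t ≤ f u + g u + (f v + g v)
  combine {u} {v} (p , q) = ≤-trans (+-mono-≤ p q)
    (≤-reflexive (≡.sym (rearrange (f u) (g u) (f v) (g v))))

TwoZeros : (A → ℕ) → List A → Set
TwoZeros f xs = ∃₂ λ u v → ∃ λ xs′ → xs ↭ u ∷ v ∷ xs′ × f u ≡ 0 × f v ≡ 0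

twoZeros-or-∑ : (f : A → ℕ) (xs : List A) → TwoZeros f xs ⊎ length xs ≤ suc (∑ f xs)
twoZeros-or-∑ {A = A} f xs
  with allPairs-or-pick {R = λ u v → 1 ≤ f u + f v} (λ u v → <-≤-connex (f u + f v) 1) xs
... | inj₁ (u , v , xs′ , σ , p) = inj₁ (u , v , xs′ , σ ,
        m+n≡0⇒m≡0 (f u) (n<1⇒n≡0 p) , m+n≡0⇒n≡0 (f u) (n<1⇒n≡0 p))
... | inj₂ ps = inj₂ (bound ps)
  where
  bound : {xs : List A} → AllPairs (λ u v → 1 ≤ f u + f v) xs → length xs ≤ suc (∑ f xs)
  bound []                 = z≤n
  bound {x ∷ xs} (p ∷ ps) with f x
  ... | zero  = s≤s (≤-trans (≤-reflexive (≡.sym (*-identityʳ (length xs)))) (∑-≥ f 1 p))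
  ... | suc m = s≤s (≤-trans (bound ps) (s≤s (m≤n+m (∑ f xs) m)))

-- Every position in the list differs from that of one of the two zeros of `g`; the crossing
-- inequality against this zero leaves the whole bound to `f`.
crossing-twoZeros : (f g : A → ℕ) {xs : List A} → Crossing 1 f g xs → TwoZeros g xs →
  All (λ x → 1 ≤ f x) xs
crossing-twoZeros f g c (u , v , xs′ , σ , gu≡0 , gv≡0)
  with AllPairs-resp-↭ Product.swap σ c
... | ((fu+gv , fv+gu) ∷ us) ∷ _ =
  All-resp-↭ (↭-sym σ)
    (drop gv≡0 fu+gv ∷ drop gu≡0 fv+gu ∷ All.map (λ p → drop gu≡0 (proj₂ p)) us)
  where
  drop : ∀ {m n} → n ≡ 0 → 1 ≤ m + n → 1 ≤ m
  drop {m} ≡.refl p = subst (1 ≤_) (+-identityʳ m) p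

module Matching {A : Set} (w : A → A → ℕ) (w-sym : ∀ x y → w x y ≡ w y x) where

  weight : List A → ℕ
  weight = pairSum w

  weight-↭ : ∀ {xs ys} → xs ↭ ys → weight xs ≡ weight ys
  weight-↭ refl         = ≡.refl
  weight-↭ (prep x σ)   = cong₂ _+_ (∑-↭ (w x) σ) (weight-↭ σ)
  weight-↭ {ys = _ ∷ _ ∷ ys} (swap x y σ)
    rewrite w-sym x y | ∑-↭ (w x) σ | ∑-↭ (w y) σ | weight-↭ σ =
    +-interchange (w y x) (∑ (w x) ys) (∑ (w y) ys) (weight ys)
  weight-↭ (trans σ τ)  = ≡.trans (weight-↭ σ) (weight-↭ τ)

  cost : List (A × A) → ℕ
  cost = ∑ (λ (p , q) → w p q)

  weight-pairwise : ∀ t {xs} → AllPairs (λ u v → t ≤ w u v) xs →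
    triangular (length xs) * t ≤ weight xs
  weight-pairwise t []                 = z≤n
  weight-pairwise t {x ∷ xs} (p ∷ ps) = begin
    (length xs + triangular (length xs)) * t
      ≡⟨ *-distribʳ-+ t (length xs) _ ⟩
    length xs * t + triangular (length xs) * t
      ≤⟨ +-mono-≤ (∑-≥ (w x) t p) (weight-pairwise t ps) ⟩
    ∑ (w x) xs + weight xs ∎
    where open ≤-Reasoning

  -- Only the weights from the pairs to `us` and those inside `us` are counted; all weights within
  -- and between pairs are dropped.
  weight-cross : ∀ c {ps} us → All (λ (p , q) → c ≤ ∑ (w p) us + ∑ (w q) us) ps →
    length ps * c + weight us ≤ weight (flatten ps ++ us)
  weight-cross c us []                               = ≤-refl
  weight-cross c {(p , q) ∷ ps} us (b ∷ bs) = begin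
    c + length ps * c + weight us
      ≡⟨ +-assoc c _ _ ⟩
    c + (length ps * c + weight us)
      ≤⟨ +-mono-≤ b (weight-cross c us bs) ⟩
    ∑ (w p) us + ∑ (w q) us + weight (flatten ps ++ us)
      ≤⟨ +-monoˡ-≤ (weight (flatten ps ++ us))
           (+-mono-≤ (∑-++-≥ʳ (w p) (q ∷ flatten ps) us) (∑-++-≥ʳ (w q) (flatten ps) us)) ⟩
    ∑ (w p) (q ∷ flatten ps ++ us) + ∑ (w q) (flatten ps ++ us) + weight (flatten ps ++ us)
      ≡⟨ +-assoc (∑ (w p) (q ∷ flatten ps ++ us)) _ _ ⟩
    ∑ (w p) (q ∷ flatten ps ++ us) + (∑ (w q) (flatten ps ++ us) + weight (flatten ps ++ us)) ∎
    where open ≤-Reasoning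

  -- Each pair of `ps` counts only through its first vertex: its weights to `us` and to the other
  -- first vertices. For hubs these are the weights known to be positive.
  weight-first : ∀ c {ps} qs us → All (λ (p , _) → c ≤ ∑ (w p) us) ps →
    AllPairs (λ (p , _) (p′ , _) → 1 ≤ w p p′) ps →
    length ps * c + triangular (length ps) + weight (flatten qs ++ us)
      ≤ weight (flatten ps ++ flatten qs ++ us)
  weight-first c qs us [] []                                 = ≤-refl
  weight-first c {(p , q) ∷ ps} qs us (b ∷ bs) (r ∷ rs) = begin
    c + length ps * c + (length ps + triangular (length ps)) + weight Y
      ≡⟨ rearrange c (length ps * c) (length ps) (triangular (length ps)) (weight Y) ⟩
    length ps + c + (length ps * c + triangular (length ps) + weight Y)
      ≤⟨ +-mono-≤ (+-mono-≤ (firsts r) (≤-trans b (∑-++-≥ʳ (w p) (flatten qs) us)))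
           (weight-first c qs us bs rs) ⟩
    ∑ (w p) (flatten ps) + ∑ (w p) Y + weight X
      ≡⟨ cong (_+ weight X) (≡.sym (∑-++ (w p) (flatten ps) Y)) ⟩
    ∑ (w p) X + weight X
      ≤⟨ +-mono-≤ (m≤n+m (∑ (w p) X) (w p q)) (m≤n+m (weight X) (∑ (w q) X)) ⟩
    w p q + ∑ (w p) X + (∑ (w q) X + weight X) ∎
    where
    open ≤-Reasoning
    Y X : List A
    Y = flatten qs ++ us
    X = flatten ps ++ Y
    rearrange : ∀ a b c d e → a + b + (c + d) + e ≡ c + a + (b + d + e)
    rearrange = solve-∀
    firsts : ∀ {rs} → All (λ (p′ , _) → 1 ≤ w p p′) rs → length rs ≤ ∑ (w p) (flatten rs)
    firsts []                        = z≤n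
    firsts {(_ , q′) ∷ _} (s ∷ ss) =
      +-mono-≤ s (≤-trans (firsts ss) (m≤n+m _ (w p q′)))

  -- ps is a matching by pairs of weight 0 and us lists its uncovered vertices.
  -- Locked t: no exchange involving at most one pair of ps covers two more
  -- vertices at total cost below t.
  Locked : ℕ → List (A × A) → List A → Set
  Locked t ps us =
    AllPairs (λ u v → t ≤ w u v) us × All (λ (p , q) → Crossing t (w p) (w q) us) ps

  Augmentation : ℕ → List (A × A) → List A → Set
  Augmentation t ps us = ∃₂ λ ps′ us′ →
    flatten ps′ ++ us′ ↭ flatten ps ++ us × length us ≡ 2 + length us′ × cost ps′ < t

  augment-or-locked : ∀ t ps us → cost ps ≡ 0 → Augmentation t ps us ⊎ Locked t ps us
  augment-or-locked t ps us free
    with allPairs-or-pick {R = λ u v → t ≤ w u v} (λ u v → <-≤-connex (w u v) t) us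
  ... | inj₁ (u , v , us′ , σ , w<t) = inj₁
    ( (u , v) ∷ ps , us′
    , trans (shifts (u ∷ v ∷ []) (flatten ps)) (++⁺ˡ (flatten ps) (↭-sym σ))
    , ↭-length σ
    , subst (_< t) (≡.sym (≡.trans (cong (w u v +_) free) (+-identityʳ _))) w<t )
  ... | inj₂ apart
    with all-or-pick (λ (p , q) → crossing-or-pick t (w p) (w q) us) ps
  ...   | inj₂ crossing = inj₂ (apart , crossing)
  ...   | inj₁ ((p , q) , qs , τ , u , v , us′ , σ , w<t) = inj₁
    ( (p , u) ∷ (q , v) ∷ qs , us′
    , trans (trans (prep p (swap u q refl))
        (++⁺ˡ (p ∷ q ∷ []) (shifts (u ∷ v ∷ []) (flatten qs))))
        (++⁺ (flatten-↭ (↭-sym τ)) (↭-sym σ))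
    , ↭-length σ
    , subst (_< t) (≡.sym cost≡) w<t )
    where
    qs-free : cost qs ≡ 0
    qs-free = m+n≡0⇒n≡0 (w p q) (≡.trans (≡.sym (∑-↭ _ τ)) free)
    cost≡ : w p u + (w q v + cost qs) ≡ w p u + w q v
    cost≡ = cong (w p u +_) (≡.trans (cong (w q v +_) qs-free) (+-identityʳ _))

  -- With `n` pairs and `D` uncovered vertices, each pair sends weight at least `D * t ≥ 2 * c` to
  -- `us`, and `us` itself carries at least `D (D - 1) t / 2 ≥ c (D - 1)`. Together this is
  -- `c (2n + D - 1)`, where `2n + D` counts all vertices.
  locked-weight : ∀ t c ps us → 2 ≤ length us → 2 * c ≤ length us * t → Locked t ps us →
    c * (length (flatten ps ++ us) ∸ 1) ≤ weight (flatten ps ++ us)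
  locked-weight t c ps us@(x ∷ xs) 2≤D 2c≤Dt (apart , crossing) = begin
    c * (length (flatten ps ++ us) ∸ 1)
      ≡⟨ cong (λ m → c * (m ∸ 1)) (length-++ (flatten ps)) ⟩
    c * (length (flatten ps) + suc e ∸ 1)
      ≡⟨ cong (λ m → c * (m + suc e ∸ 1)) (length-flatten ps) ⟩
    c * (length ps * 2 + suc e ∸ 1)
      ≡⟨ cong (λ m → c * (m ∸ 1)) (+-suc (length ps * 2) e) ⟩
    c * (length ps * 2 + e)
      ≡⟨ split c (length ps) e ⟩
    length ps * (2 * c) + c * e
      ≤⟨ +-mono-≤ (*-monoʳ-≤ (length ps) 2c≤Dt) uncovered ⟩
    length ps * (suc e * t) + triangular (suc e) * t
      ≤⟨ +-monoʳ-≤ _ (weight-pairwise t apart) ⟩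
    length ps * (suc e * t) + weight us
      ≤⟨ weight-cross (suc e * t) us
           (All.map (λ {(p , q)} → crossing-∑ t (w p) (w q) 2≤D) crossing) ⟩
    weight (flatten ps ++ us) ∎
    where
    open ≤-Reasoning
    e : ℕ
    e = length xs
    split : ∀ c n e → c * (n * 2 + e) ≡ n * (2 * c) + c * e
    split = solve-∀
    swapʳ : ∀ a b c → a * b * c ≡ a * c * b
    swapʳ = solve-∀
    uncovered : c * e ≤ triangular (suc e) * t
    uncovered = *-cancelˡ-≤ 2 (begin
      2 * (c * e)                  ≡⟨ *-assoc 2 c e ⟨
      2 * c * e                    ≤⟨ *-monoˡ-≤ e 2c≤Dt ⟩
      suc e * t * e                ≡⟨ swapʳ (suc e) t e ⟩
      suc e * e * t                ≡⟨ cong (_* t) (2*triangular e) ⟨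
      2 * triangular (suc e) * t   ≡⟨ *-assoc 2 (triangular (suc e)) t ⟩
      2 * (triangular (suc e) * t) ∎)

  Cover : List A → ℕ → ℕ → Set
  Cover xs c D = ∃₂ λ ps us → flatten ps ++ us ↭ xs × length us ≡ D × cost ps ≤ c

  -- If no augmentation of cost at most `t` existed, the matching would be locked at `suc t`, and
  -- `locked-weight` would contradict the bound on the weight.
  augment : ∀ {xs} t c D → weight xs < c * (length xs ∸ 1) → 2 * c ≤ (2 + D) * suc t →
    Cover xs 0 (2 + D) → Cover xs t D
  augment t c D light 2c≤ (ps , us , σ , len , free)
    with augment-or-locked (suc t) ps us (n≤0⇒n≡0 free)
  ... | inj₁ (ps′ , us′ , τ , len′ , c<t) =
    ps′ , us′ , trans τ σ ,
    suc-injective (suc-injective (≡.trans (≡.sym len′) len)) , ≤-pred c<t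
  ... | inj₂ locked = contradiction
    (≤-trans (≤-reflexive (cong (λ m → c * (m ∸ 1)) (↭-length (↭-sym σ))))
      (≤-trans (locked-weight (suc t) c ps us
        (subst (2 ≤_) (≡.sym len) (s≤s (s≤s z≤n)))
        (subst (λ m → 2 * c ≤ m * suc t) (≡.sym len) 2c≤) locked)
      (≤-reflexive (weight-↭ σ))))
    (<⇒≱ light)

  -- Before each round at least `2 + D` vertices are uncovered, so one inequality serves all rounds.
  augment-iterate : ∀ {xs} c D k → weight xs < c * (length xs ∸ 1) → 2 * c ≤ 2 + D →
    Cover xs 0 (k * 2 + D) → Cover xs 0 D
  augment-iterate c D zero    light 2c≤ cover = cover
  augment-iterate c D (suc k) light 2c≤ cover = augment-iterate c D k light 2c≤
    (augment 0 c (k * 2 + D) light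
      (≤-trans 2c≤ (≤-trans (+-monoʳ-≤ 2 (m≤n+m D (k * 2))) (≤-reflexive (≡.sym (*-identityʳ _)))))
      cover)

  light-perfect-matching : ∀ xs k → length xs ≡ suc k * 2 → weight xs < 2 * (length xs ∸ 1) →
    ∃ λ ps → flatten ps ↭ xs × cost ps ≤ 1
  light-perfect-matching xs k len light
    -- With `c = 2`, augmenting is free while at least 4 vertices are uncovered. For the last 2, the
    -- product `2 * 2` reaches `2 * c` at threshold 2, so this augmentation may cost 1.
    with augment 1 2 0 light ≤-refl (augment-iterate 2 2 k light ≤-refl
      ([] , xs , refl , ≡.trans len (+-comm 2 (k * 2)) , z≤n))
  ... | ps , [] , σ , _ , light-cost = ps , subst (_↭ xs) (++-identityʳ (flatten ps)) σ , light-cost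

  -- In a locked matching a pair (p , q) with few positive weights towards us
  -- has, up to order, q joined by weight 0 to two vertices of us and hence p to none.
  Hub : List A → A × A → Set
  Hub us (p , q) = length us ≤ ∑ (w p) us × TwoZeros (w q) us

  crossing-hub : ∀ us p q → Crossing 1 (w p) (w q) us → TwoZeros (w q) us → Hub us (p , q)
  crossing-hub us p q c z =
    ≤-trans (≤-reflexive (≡.sym (*-identityʳ _)))
      (∑-≥ (w p) 1 (crossing-twoZeros (w p) (w q) c z)) , z

  -- If neither `p` nor `q` has two zeros in `us`, each of them has positive weight to all but at
  -- most one vertex there.
  hub-or-cross : ∀ us p q → Crossing 1 (w p) (w q) us →
    (Hub us (p , q) ⊎ Hub us (q , p)) ⊎ 2 * (length us ∸ 1) ≤ ∑ (w p) us + ∑ (w q) us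
  hub-or-cross us p q c with twoZeros-or-∑ (w p) us | twoZeros-or-∑ (w q) us
  ... | _      | inj₁ z = inj₁ (inj₁ (crossing-hub us p q c z))
  ... | inj₁ z | _      = inj₁ (inj₂ (crossing-hub us q p (crossing-swap (w p) (w q) c) z))
  ... | inj₂ b | inj₂ b′ = inj₂ (≤-trans
      (≤-reflexive (cong (length us ∸ 1 +_) (+-identityʳ _)))
      (+-mono-≤ (∸-monoˡ-≤ 1 b) (∸-monoˡ-≤ 1 b′)))

  record HubSplit (ps : List (A × A)) (us : List A) : Set where
    field
      hubs others : List (A × A)
      perm        : flatten hubs ++ flatten others ↭ flatten ps
      count       : length hubs + length others ≡ length ps
      cost-hubs   : cost hubs ≤ cost ps
      cost-others : cost others ≤ cost ps
      are-hubs    : All (Hub us) hubs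
      cross       : All (λ (p , q) → 2 * (length us ∸ 1) ≤ ∑ (w p) us + ∑ (w q) us) others

  hubSplit : ∀ ps us → All (λ (p , q) → Crossing 1 (w p) (w q) us) ps → HubSplit ps us
  hubSplit []             us []       = record
    { hubs = [] ; others = [] ; perm = refl ; count = ≡.refl
    ; cost-hubs = z≤n ; cost-others = z≤n ; are-hubs = [] ; cross = [] }
  hubSplit ((p , q) ∷ ps) us (c ∷ cs) with hub-or-cross us p q c | hubSplit ps us cs
  ... | inj₁ (inj₁ h) | split = record
    { hubs = (p , q) ∷ hubs ; others = others
    ; perm = prep p (prep q perm) ; count = cong suc count
    ; cost-hubs = +-monoʳ-≤ (w p q) cost-hubs
    ; cost-others = ≤-trans cost-others (m≤n+m _ (w p q))
    ; are-hubs = h ∷ are-hubs ; cross = cross }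
    where open HubSplit split
  ... | inj₁ (inj₂ h) | split = record
    { hubs = (q , p) ∷ hubs ; others = others
    ; perm = swap q p perm ; count = cong suc count
    ; cost-hubs = +-mono-≤ (≤-reflexive (w-sym q p)) cost-hubs
    ; cost-others = ≤-trans cost-others (m≤n+m _ (w p q))
    ; are-hubs = h ∷ are-hubs ; cross = cross }
    where open HubSplit split
  ... | inj₂ b        | split = record
    { hubs = hubs ; others = (p , q) ∷ others
    ; perm = trans (shifts (flatten hubs) (p ∷ q ∷ [])) (prep p (prep q perm))
    ; count = ≡.trans (+-suc _ _) (cong suc count)
    ; cost-hubs = ≤-trans cost-hubs (m≤n+m _ (w p q))
    ; cost-others = +-monoʳ-≤ (w p q) cost-others
    ; are-hubs = are-hubs ; cross = b ∷ cross }
    where open HubSplit split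

  -- If w p p′ vanishes for two hubs, then u q p p′ q′ v is an augmenting path.
  augment-or-hubs : ∀ hs os us → cost hs ≡ 0 → cost os ≡ 0 → All (Hub us) hs →
    (∃₂ λ ps′ us′ → flatten ps′ ++ us′ ↭ flatten hs ++ flatten os ++ us ×
      length us ≡ 2 + length us′ × cost ps′ ≡ 0)
    ⊎ AllPairs (λ (p , _) (p′ , _) → 1 ≤ w p p′) hs
  augment-or-hubs hs os us free-hs free-os are-hubs
    with allPairs-or-pick {R = λ (p , _) (p′ , _) → 1 ≤ w p p′}
           (λ (p , _) (p′ , _) → <-≤-connex (w p p′) 1) hs
  ... | inj₂ apart = inj₂ apart
  ... | inj₁ ((p , q) , (p′ , q′) , rs , σ , wpp′) with All-resp-↭ σ are-hubs
  ...   | (_ , zq) ∷ (_ , (x , y , _ , ρ , q′x≡0 , _)) ∷ _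
    with crossing-or-pick 1 (w q) (w q′) us
  -- If no two entries of `us` could serve as `u` and `v`, the two zeros of `w q` would make `w q′`
  -- positive on all of `us`, against its zero at `x`.
  ...     | inj₂ c = contradiction q′x≡0
    (>⇒≢ (All.head (All-resp-↭ ρ (crossing-twoZeros (w q′) (w q) (crossing-swap (w q) (w q′) c) zq))))
  ...     | inj₁ (u , v , us′ , τ , wuv) = inj₁
    ( (p , p′) ∷ (q , u) ∷ (q′ , v) ∷ rs ++ os , us′
    , trans (↭-reflexive (cong (λ zs → p ∷ p′ ∷ q ∷ u ∷ q′ ∷ v ∷ zs)
          (≡.trans (cong (_++ us′) (flatten-++ rs os)) (++-assoc (flatten rs) (flatten os) us′))))
      (trans (prep p (trans (swap p′ q refl) (prep q (prep p′ (swap u q′ refl)))))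
      (trans (++⁺ˡ (p ∷ q ∷ p′ ∷ q′ ∷ []) (trans (shifts (u ∷ v ∷ []) (flatten rs))
               (++⁺ˡ (flatten rs) (shifts (u ∷ v ∷ []) (flatten os)))))
        (++⁺ (flatten-↭ (↭-sym σ)) (++⁺ˡ (flatten os) (↭-sym τ)))))
    , ↭-length τ
    , cost≡0 )
    where
    rs-free : cost rs ≡ 0
    rs-free = m+n≡0⇒n≡0 (w p′ q′) (m+n≡0⇒n≡0 (w p q) (≡.trans (≡.sym (∑-↭ _ σ)) free-hs))
    cost≡0 : w p p′ + (w q u + (w q′ v + cost (rs ++ os))) ≡ 0
    cost≡0 rewrite n<1⇒n≡0 wpp′ | m+n≡0⇒m≡0 (w q u) (n<1⇒n≡0 wuv)
      | m+n≡0⇒n≡0 (w q u) (n<1⇒n≡0 wuv)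
      | ∑-++ (λ (p , q) → w p q) rs os | rs-free | free-os = ≡.refl

  -- With 5 uncovered vertices, `h` hubs and `o` other pairs, the weight found is
  -- `5h + triangular h + 8o + 10`, to be compared with `3 (2h + 2o + 4)`; what remains is this
  -- inequality. It fails at `h = 3`, `o = 0`, so 4 pairs are asked for, that is `2 * 4 + 5 = 13`
  -- vertices.
  hub-count : ∀ h o → 4 ≤ h + o → 2 + h ≤ triangular h + 2 * o
  hub-count 0 (suc o) _ = ≤-trans (s≤s (s≤s z≤n)) (*-monoʳ-≤ 2 (s≤s (z≤n {o})))
  hub-count 1 (suc (suc o)) _ = ≤-trans (n≤1+n 3) (*-monoʳ-≤ 2 (s≤s (s≤s (z≤n {o}))))
  hub-count 1 0 (s≤s ())
  hub-count 2 0 (s≤s (s≤s ()))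
  hub-count 1 1 (s≤s (s≤s ()))
  hub-count 2 (suc (suc o)) _ = ≤-trans (n≤1+n 4) (s≤s (*-monoʳ-≤ 2 (s≤s (s≤s (z≤n {o})))))
  hub-count 2 1 (s≤s (s≤s (s≤s ())))
  hub-count 3 (suc o) _ = s≤s (s≤s (s≤s (*-monoʳ-≤ 2 (s≤s (z≤n {o})))))
  hub-count 3 0 (s≤s (s≤s (s≤s ())))
  hub-count (suc (suc (suc (suc h)))) o _ = ≤-trans (large h) (m≤m+n _ (2 * o))
    where
    large : ∀ h → 6 + h ≤ triangular (4 + h)
    large zero    = ≤-refl
    large (suc h) = ≤-trans (s≤s (large h)) (+-monoˡ-≤ (triangular (4 + h)) {1} {4 + h} (s≤s z≤n))

  -- With 5 uncovered vertices the bound of locked-weight falls short of 3(|xs| - 1);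
  -- the weights between hubs make up for it as soon as there are 4 pairs.
  augment₅ : ∀ {xs} → 13 ≤ length xs → weight xs < 3 * (length xs ∸ 1) → Cover xs 0 5 → Cover xs 0 3
  augment₅ {xs} 13≤ light (ps , us , σ , len , free)
    with augment-or-locked 1 ps us (n≤0⇒n≡0 free)
  ... | inj₁ (ps′ , us′ , τ , len′ , c<1) =
    ps′ , us′ , trans τ σ ,
    suc-injective (suc-injective (≡.trans (≡.sym len′) len)) , ≤-pred c<1
  ... | inj₂ (apart , crossing) =
    [ (λ (ps′ , us′ , τ , len′ , c≡0) →
          ps′ , us′ , trans τ π ,
          suc-injective (suc-injective (≡.trans (≡.sym len′) len)) , ≤-reflexive c≡0)
    , (λ hubs-apart → contradiction (heavy hubs-apart) (<⇒≱ light))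
    ]′ (augment-or-hubs hubs others us
          (n≤0⇒n≡0 (≤-trans cost-hubs free)) (n≤0⇒n≡0 (≤-trans cost-others free)) are-hubs)
    where
    open ≤-Reasoning
    open HubSplit (hubSplit ps us crossing)
    h o : ℕ
    h = length hubs
    o = length others
    π : flatten hubs ++ flatten others ++ us ↭ xs
    π = trans (trans (↭-reflexive (≡.sym (++-assoc (flatten hubs) (flatten others) us)))
      (++⁺ʳ us perm)) σ
    length≡ : length xs ≡ (h + o) * 2 + 5
    length≡ = ≡.trans (↭-length (↭-sym σ)) (≡.trans (length-++ (flatten ps))
      (cong₂ _+_ (≡.trans (length-flatten ps) (cong (_* 2) (≡.sym count))) len))
    4≤h+o : 4 ≤ h + o
    4≤h+o = *-cancelʳ-≤ 4 (h + o) 2 (+-cancelʳ-≤ 5 8 _ (subst (13 ≤_) length≡ 13≤))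
    rearrange₁ : ∀ h o → 3 * ((h + o) * 2 + 4) ≡ h * 5 + 6 * o + 10 + (2 + h)
    rearrange₁ = solve-∀
    rearrange₂ : ∀ h o t → h * 5 + 6 * o + 10 + (t + 2 * o) ≡ h * 5 + t + (o * 8 + 10)
    rearrange₂ = solve-∀
    hub-bounds : All (λ (p , _) → 5 ≤ ∑ (w p) us) hubs
    hub-bounds = subst (λ m → All (λ (p , _) → m ≤ ∑ (w p) us) hubs) len (All.map proj₁ are-hubs)
    cross-bounds : All (λ (p , q) → 8 ≤ ∑ (w p) us + ∑ (w q) us) others
    cross-bounds =
      subst (λ m → All (λ (p , q) → 2 * (m ∸ 1) ≤ ∑ (w p) us + ∑ (w q) us) others) len cross
    heavy : AllPairs (λ (p , _) (p′ , _) → 1 ≤ w p p′) hubs → 3 * (length xs ∸ 1) ≤ weight xs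
    heavy hubs-apart = begin
      3 * (length xs ∸ 1)
        ≡⟨ cong (λ m → 3 * (m ∸ 1)) length≡ ⟩
      3 * ((h + o) * 2 + 5 ∸ 1)
        ≡⟨ cong (λ m → 3 * (m ∸ 1)) (+-suc ((h + o) * 2) 4) ⟩
      3 * ((h + o) * 2 + 4)
        ≡⟨ rearrange₁ h o ⟩
      h * 5 + 6 * o + 10 + (2 + h)
        ≤⟨ +-monoʳ-≤ (h * 5 + 6 * o + 10) (hub-count h o 4≤h+o) ⟩
      h * 5 + 6 * o + 10 + (triangular h + 2 * o)
        ≡⟨ rearrange₂ h o (triangular h) ⟩
      h * 5 + triangular h + (o * 8 + 10)
        ≤⟨ +-monoʳ-≤ (h * 5 + triangular h) (+-monoʳ-≤ (o * 8)
             (subst (λ m → triangular m * 1 ≤ weight us) len (weight-pairwise 1 apart))) ⟩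
      h * 5 + triangular h + (o * 8 + weight us)
        ≤⟨ +-monoʳ-≤ (h * 5 + triangular h) (weight-cross 8 us cross-bounds) ⟩
      h * 5 + triangular h + weight (flatten others ++ us)
        ≤⟨ weight-first 5 others us hub-bounds hubs-apart ⟩
      weight (flatten hubs ++ flatten others ++ us)
        ≡⟨ weight-↭ π ⟩
      weight xs ∎

  light-near-perfect-matching : ∀ xs k → length xs ≡ k * 2 + 1 → 13 ≤ length xs →
    weight xs < 3 * (length xs ∸ 1) →
    ∃₂ λ ps l → flatten ps ++ l ∷ [] ↭ xs × cost ps ≤ 1
  light-near-perfect-matching xs 0 len 13≤ light =
    contradiction (subst (13 ≤_) len 13≤) λ { (s≤s ()) }
  light-near-perfect-matching xs 1 len 13≤ light =
    contradiction (subst (13 ≤_) len 13≤) λ { (s≤s (s≤s (s≤s ()))) }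
  light-near-perfect-matching xs (suc (suc k)) len 13≤ light
    -- With `c = 3`, `locked-weight` at threshold 1 needs 6 uncovered vertices, by parity 7, so the
    -- iteration stops at 5. From there `augment₅` leads to 3, where `3 * 2 = 2 * c` allows a last
    -- augmentation of cost at most 1.
    with augment 1 3 1 light ≤-refl (augment₅ 13≤ light (augment-iterate 3 5 k light (n≤1+n 6)
      ([] , xs , refl , ≡.trans len (lemma k) , z≤n)))
    where
    lemma : ∀ k → (2 + k) * 2 + 1 ≡ k * 2 + 5
    lemma = solve-∀
  ... | ps , l ∷ [] , σ , _ , light-cost = ps , l , σ , light-cost

-- Colour pairs

∑-0 : ∀ (f : A → ℕ) {xs} → All (λ x → f x ≡ 0) xs → ∑ f xs ≡ 0
∑-0 f []       = ≡.refl
∑-0 f (p ∷ ps) = cong₂ _+_ p (∑-0 f ps)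

∑-*ˡ : ∀ c (f : A → ℕ) xs → ∑ (λ x → c * f x) xs ≡ c * ∑ f xs
∑-*ˡ c f []       = ≡.sym (*-zeroʳ c)
∑-*ˡ c f (x ∷ xs) = ≡.trans (cong (c * f x +_) (∑-*ˡ c f xs)) (≡.sym (*-distribˡ-+ c (f x) _))

∑-≥-member : ∀ (f : A → ℕ) {x xs} → x ∈ˡ xs → f x ≤ ∑ f xs
∑-≥-member f (here ≡.refl)           = m≤m+n _ _
∑-≥-member f {xs = y ∷ _} (there p) = ≤-trans (∑-≥-member f p) (m≤n+m _ (f y))

-- At most one value is nonzero. If none is, the head is picked, so the picked element need not have
-- a positive value.
∑≤1-pick : ∀ (f : A → ℕ) xs → ∑ f xs ≤ 1 →
  xs ≡ [] ⊎ ∃₂ λ x xs′ → xs ↭ x ∷ xs′ × ∑ f xs′ ≡ 0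
∑≤1-pick f xs light
  with all-or-pick {R = λ x → f x < 1} (λ x → [ inj₂ , inj₁ ]′ (<-≤-connex (f x) 1)) xs
∑≤1-pick f xs       light | inj₁ (x , xs′ , σ , 1≤fx) = inj₂ (x , xs′ , σ ,
  n≤0⇒n≡0 (+-cancelˡ-≤ 1 _ _ (≤-trans (+-monoˡ-≤ (∑ f xs′) 1≤fx)
    (subst (_≤ 1) (∑-↭ f σ) light))))
∑≤1-pick f []       light | inj₂ _       = inj₁ ≡.refl
∑≤1-pick f (x ∷ xs) light | inj₂ (_ ∷ z) = inj₂ (x , xs , refl , ∑-0 f (All.map n<1⇒n≡0 z))

-- Counting conflicts by their colours

𝟙 : ℕ → ℕ → ℕ
𝟙 p x with p ≟ x
... | yes _ = 1
... | no  _ = 0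

𝟙-refl : ∀ p → 𝟙 p p ≡ 1
𝟙-refl p with p ≟ p
... | yes _   = ≡.refl
... | no  p≢p = contradiction ≡.refl p≢p

𝟙-≢ : ∀ {p x} → p ≢ x → 𝟙 p x ≡ 0
𝟙-≢ {p} {x} p≢x with p ≟ x
... | yes p≡x = contradiction p≡x p≢x
... | no  _   = ≡.refl

∑-𝟙-unique : ∀ p {xs} → Unique xs → ∑ (𝟙 p) xs ≤ 1
∑-𝟙-unique p []                  = z≤n
∑-𝟙-unique p {x ∷ xs} (x∉xs ∷ u) with p ≟ x
... | yes ≡.refl = s≤s (≤-reflexive (∑-0 (𝟙 p) (All.map 𝟙-≢ x∉xs)))
... | no  _      = ∑-𝟙-unique p u

-- For `a ≢ b` this is the indicator of equality between `(p , q)` and `(a , b)` as unordered pairs.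
-- The form with products lets sums factor.
joins : ℕ × ℕ → ℕ → ℕ → ℕ
joins (p , q) a b = 𝟙 p a * 𝟙 q b + 𝟙 p b * 𝟙 q a

joins-sym : ∀ e a b → joins e a b ≡ joins e b a
joins-sym (p , q) a b = +-comm (𝟙 p a * 𝟙 q b) (𝟙 p b * 𝟙 q a)

joins-≢ : ∀ {p q b} a → p ≢ b → q ≢ b → joins (p , q) a b ≡ 0
joins-≢ {p} a p≢b q≢b rewrite 𝟙-≢ p≢b | 𝟙-≢ q≢b = cong (_+ 0) (*-zeroʳ (𝟙 p a))

-- Expanding the product on the right gives the terms on the left and the diagonal ones
-- `𝟙 p x * 𝟙 q x`.
pairSum-joins : ∀ p q xs → pairSum (joins (p , q)) xs ≤ ∑ (𝟙 p) xs * ∑ (𝟙 q) xs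
pairSum-joins p q []       = z≤n
pairSum-joins p q (x ∷ xs) = begin
  ∑ (joins (p , q) x) xs + pairSum (joins (p , q)) xs
    ≡⟨ cong (_+ pairSum (joins (p , q)) xs) (∑-+ (λ y → 𝟙 p x * 𝟙 q y) (λ y → 𝟙 p y * 𝟙 q x) xs) ⟩
  ∑ (λ y → 𝟙 p x * 𝟙 q y) xs + ∑ (λ y → 𝟙 p y * 𝟙 q x) xs + pairSum (joins (p , q)) xs
    ≤⟨ +-mono-≤ (≤-reflexive (cong₂ _+_ (∑-*ˡ (𝟙 p x) (𝟙 q) xs) (∑-*ʳ xs))) (pairSum-joins p q xs) ⟩
  𝟙 p x * ∑ (𝟙 q) xs + 𝟙 q x * ∑ (𝟙 p) xs + ∑ (𝟙 p) xs * ∑ (𝟙 q) xs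
    ≤⟨ m≤m+n _ (𝟙 p x * 𝟙 q x) ⟩
  𝟙 p x * ∑ (𝟙 q) xs + 𝟙 q x * ∑ (𝟙 p) xs + ∑ (𝟙 p) xs * ∑ (𝟙 q) xs + 𝟙 p x * 𝟙 q x
    ≡⟨ expand (𝟙 p x) (𝟙 q x) (∑ (𝟙 p) xs) (∑ (𝟙 q) xs) ⟩
  (𝟙 p x + ∑ (𝟙 p) xs) * (𝟙 q x + ∑ (𝟙 q) xs) ∎
  where
  open ≤-Reasoning
  expand : ∀ a b c d → a * d + b * c + c * d + a * b ≡ (a + c) * (b + d)
  expand = solve-∀
  ∑-*ʳ : ∀ ys → ∑ (λ y → 𝟙 p y * 𝟙 q x) ys ≡ 𝟙 q x * ∑ (𝟙 p) ys
  ∑-*ʳ []       = ≡.sym (*-zeroʳ (𝟙 q x))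
  ∑-*ʳ (y ∷ ys) = ≡.trans (cong₂ _+_ (*-comm (𝟙 p y) (𝟙 q x)) (∑-*ʳ ys))
    (≡.sym (*-distribˡ-+ (𝟙 q x) (𝟙 p y) _))

multiplicity : List (ℕ × ℕ) → ℕ → ℕ → ℕ
multiplicity es a b = ∑ (λ e → joins e a b) es

multiplicity-sym : ∀ es a b → multiplicity es a b ≡ multiplicity es b a
multiplicity-sym []       a b = ≡.refl
multiplicity-sym (e ∷ es) a b = cong₂ _+_ (joins-sym e a b) (multiplicity-sym es a b)

-- In a list without repetitions `∑ (𝟙 p)` and `∑ (𝟙 q)` are at most 1, so a single conflict adds at
-- most 1 to the total weight.
pairSum-multiplicity : ∀ es {xs} → Unique xs → pairSum (multiplicity es) xs ≤ length es
pairSum-multiplicity []             {xs} u = ≤-reflexive (pairSum-0 xs)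
  where
  pairSum-0 : ∀ (xs : List ℕ) → pairSum (multiplicity []) xs ≡ 0
  pairSum-0 []       = ≡.refl
  pairSum-0 (x ∷ xs) = cong₂ _+_ (∑-0 _ (All.universal (λ _ → ≡.refl) xs)) (pairSum-0 xs)
pairSum-multiplicity ((p , q) ∷ es) {xs} u = begin
  pairSum (multiplicity ((p , q) ∷ es)) xs
    ≡⟨ pairSum-+ (joins (p , q)) (multiplicity es) xs ⟩
  pairSum (joins (p , q)) xs + pairSum (multiplicity es) xs
    ≤⟨ +-mono-≤ (≤-trans (pairSum-joins p q xs) (*-mono-≤ (∑-𝟙-unique p u) (∑-𝟙-unique q u)))
         (pairSum-multiplicity es u) ⟩
  1 + length es ∎
  where open ≤-Reasoning

-- Colours handed out to the classes

infix 4 _∈ₚ_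
_∈ₚ_ : ℕ → ℕ × ℕ → Set
x ∈ₚ (a , b) = x ≡ a ⊎ x ≡ b

-- Past the end of the list, slot j receives a colour of its own, at least b,
-- encoded as a pair with equal components.
unit : List (ℕ × ℕ) → ℕ → ℕ → ℕ × ℕ
unit []       b j       = b + j , b + j
unit (p ∷ ps) b zero    = p
unit (p ∷ ps) b (suc j) = unit ps b j

unit-∈ : ∀ ps b j → unit ps b j ∈ˡ ps ⊎ b ≤ proj₁ (unit ps b j)
unit-∈ []       b j       = inj₂ (m≤m+n b j)
unit-∈ (p ∷ ps) b zero    = inj₁ (here ≡.refl)
unit-∈ (p ∷ ps) b (suc j) = [ inj₁ ∘ there , inj₂ ]′ (unit-∈ ps b j)

∈-flatten : ∀ ps b j {x} → x ∈ₚ unit ps b j → x ∈ˡ flatten ps ⊎ b ≤ x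
∈-flatten []       b j       (inj₁ ≡.refl) = inj₂ (m≤m+n b j)
∈-flatten []       b j       (inj₂ ≡.refl) = inj₂ (m≤m+n b j)
∈-flatten (p ∷ ps) b zero    (inj₁ ≡.refl) = inj₁ (here ≡.refl)
∈-flatten (p ∷ ps) b zero    (inj₂ ≡.refl) = inj₁ (there (here ≡.refl))
∈-flatten (p ∷ ps) b (suc j) x∈            =
  [ inj₁ ∘ there ∘ there , inj₂ ]′ (∈-flatten ps b j x∈)

-- Past the end, slot `j` has the colour `b + (j - length ps)`; a colour from a listed pair is below
-- `b`, which suffices by `length ps ≤ r`. Keeping `length ps` on the left avoids truncated
-- subtraction.
unit-bound : ∀ {ps b j r x} → All (_< b) (flatten ps) → length ps ≤ r → j < r →
  x ∈ₚ unit ps b j → length ps + x < b + r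
unit-bound {[]} {b} _ _ j<r (inj₁ ≡.refl) = +-monoʳ-< b j<r
unit-bound {[]} {b} _ _ j<r (inj₂ ≡.refl) = +-monoʳ-< b j<r
unit-bound {ps@(_ ∷ _)} {b} {zero} {r} {x} (p<b ∷ q<b ∷ _) m≤r _ x∈ =
  subst (length ps + x <_) (+-comm r b) (+-mono-≤-< m≤r
    ([ (λ { ≡.refl → p<b }) , (λ { ≡.refl → q<b }) ]′ x∈))
unit-bound {_ ∷ ps} {b} {suc j} {suc r} {x} (_ ∷ _ ∷ small) (s≤s m≤r) (s≤s j<r) x∈ =
  subst (suc (length ps + x) <_) (≡.sym (+-suc b r)) (s≤s (unit-bound {ps} small m≤r j<r x∈))

unit-disjoint : ∀ {ps b} → Unique (flatten ps) → All (_< b) (flatten ps) →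
  ∀ i j {x} → x ∈ₚ unit ps b i → x ∈ₚ unit ps b j → i ≡ j
unit-disjoint {[]} {b} _ _ i j p q = +-cancelˡ-≡ b i j (≡.trans (≡.sym (same p)) (same q))
  where
  same : ∀ {x y} → x ∈ₚ (y , y) → x ≡ y
  same (inj₁ p) = p
  same (inj₂ p) = p
unit-disjoint {(p , q) ∷ ps} {b} ((_ ∷ p∉) ∷ q∉ ∷ u) (p<b ∷ q<b ∷ small) = disjoint
  where
  fresh : ∀ j {x} → x ∈ₚ (p , q) → x ∈ₚ unit ps b j → ⊥
  fresh j x∈ x∈′ with x∈ | ∈-flatten ps b j x∈′
  ... | inj₁ ≡.refl | inj₁ x∈ps = All.lookup p∉ x∈ps ≡.refl
  ... | inj₁ ≡.refl | inj₂ b≤x  = <⇒≱ p<b b≤x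
  ... | inj₂ ≡.refl | inj₁ x∈ps = All.lookup q∉ x∈ps ≡.refl
  ... | inj₂ ≡.refl | inj₂ b≤x  = <⇒≱ q<b b≤x
  disjoint : ∀ i j {x} → x ∈ₚ unit ((p , q) ∷ ps) b i → x ∈ₚ unit ((p , q) ∷ ps) b j → i ≡ j
  disjoint zero    zero    _  _  = ≡.refl
  disjoint zero    (suc j) x∈ x∈′ = contradiction x∈′ (fresh j x∈)
  disjoint (suc i) zero    x∈ x∈′ = contradiction x∈ (fresh i x∈′)
  disjoint (suc i) (suc j) x∈ x∈′ = cong suc (unit-disjoint {ps} u small i j x∈ x∈′)

flatten-≢ : ∀ {ps : List (A × A)} {a b} → Unique (flatten ps) → (a , b) ∈ˡ ps → a ≢ b
flatten-≢ ((a≢b ∷ _) ∷ _) (here ≡.refl) = a≢b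
flatten-≢ (_ ∷ _ ∷ u)     (there p)     = flatten-≢ u p

pair-injective : ∀ {n} {x y u v : Fin n} → u ≢ v → ⁅ u ⁆ ∪ ⁅ v ⁆ ≡ ⁅ x ⁆ ∪ ⁅ y ⁆ →
  (x ≡ u × y ≡ v) ⊎ (x ≡ v × y ≡ u)
pair-injective {x = x} {y} {u} {v} u≢v eq
  with member u (x∈p∪q⁺ (inj₁ (x∈⁅x⁆ u))) | member v (x∈p∪q⁺ {p = ⁅ u ⁆} (inj₂ (x∈⁅x⁆ v)))
  where
  member : ∀ t → t ∈ ⁅ u ⁆ ∪ ⁅ v ⁆ → t ≡ x ⊎ t ≡ y
  member t t∈ = [ inj₁ ∘ x∈⁅y⁆⇒x≡y x , inj₂ ∘ x∈⁅y⁆⇒x≡y y ]′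
    (x∈p∪q⁻ ⁅ x ⁆ ⁅ y ⁆ (subst (t ∈_) eq t∈))
... | inj₁ ≡.refl | inj₁ ≡.refl = contradiction ≡.refl u≢v
... | inj₁ ≡.refl | inj₂ ≡.refl = inj₁ (≡.refl , ≡.refl)
... | inj₂ ≡.refl | inj₁ ≡.refl = inj₂ (≡.refl , ≡.refl)
... | inj₂ ≡.refl | inj₂ ≡.refl = contradiction ≡.refl u≢v

-- Extending a precolouring

module _ {n} (G : Graph (Fin n)) (P : Subset n) where

  CommonNeighbour : Fin n → Fin n → Set
  CommonNeighbour y z = ∃ λ v → Adj G v y × Adj G v z

  commonNeighbour⇒𝒟 : ∀ {y z} → y ∈ P → z ∈ P → y ≢ z → CommonNeighbour y z →
    𝒟 G P 2 (⁅ y ⁆ ∪ ⁅ z ⁆)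
  commonNeighbour⇒𝒟 {y} {z} y∈P z∈P y≢z (v , vy , vz) =
    y , z , ≡.refl , y∈P , z∈P , y≢z , distance
    where
    distance : DistanceAtMost G 2 y z
    distance with Adj? G y z
    ... | yes yz = 1 , (yz ∷ [] , λ { zero [] → contradiction ≡.refl y≢z ; (suc _) _ → s≤s z≤n }) ,
      s≤s z≤n
    ... | no ¬yz = 2 , (Graph.sym G vy ∷ vz ∷ [] ,
      λ { zero [] → contradiction ≡.refl y≢z
        ; (suc zero) (yz ∷ []) → contradiction yz ¬yz
        ; (suc (suc _)) _ → s≤s (s≤s z≤n) }) , ≤-refl

  Covers : List (Fin n × Fin n) → Set
  Covers E = ∀ {y z} → y ∈ P → z ∈ P → y ≢ z → CommonNeighbour y z →
    (y , z) ∈ˡ E ⊎ (z , y) ∈ˡ E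

  cardinality⇒covers : ∀ {c} → HasCardinality (𝒟 G P 2) c → ∃ λ E → length E ≡ c × Covers E
  cardinality⇒covers {c} (Ss , _ , Ss⇔ , len) with endpoints (All.tabulate (Equivalence.to (Ss⇔ _)))
    where
    endpoints : ∀ {Ss} → All (𝒟 G P 2) Ss → ∃ λ (E : List (Fin n × Fin n)) →
      length E ≡ length Ss × (∀ {S} → S ∈ˡ Ss → ∃₂ λ x y → S ≡ ⁅ x ⁆ ∪ ⁅ y ⁆ × (x , y) ∈ˡ E)
    endpoints []                          = [] , ≡.refl , λ ()
    endpoints ((x , y , eq , _) ∷ ds) with endpoints ds
    ... | E , len , f = (x , y) ∷ E , cong suc len , λ where
      (here ≡.refl) → x , y , eq , here ≡.refl
      (there S∈) → let (x′ , y′ , eq′ , e∈) = f S∈ in x′ , y′ , eq′ , there e∈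
  ... | E , lenE , f = E , ≡.trans lenE len , covers
    where
    covers : Covers E
    covers y∈P z∈P y≢z cn
      with f (Equivalence.from (Ss⇔ _) (commonNeighbour⇒𝒟 y∈P z∈P y≢z cn))
    ... | x′ , y′ , eq , e∈ with pair-injective y≢z eq
    ...   | inj₁ (≡.refl , ≡.refl) = inj₁ e∈
    ...   | inj₂ (≡.refl , ≡.refl) = inj₂ e∈

  module _ {s} (d : ∃ (_∈ P) → Fin s) where

    -- The value 0 outside P is junk.
    colour : Fin n → ℕ
    colour v with v ∈? P
    ... | yes v∈P = toℕ (d (v , v∈P))
    ... | no  _   = 0

    colour≡ : ∀ v (v∈P : v ∈ P) → colour v ≡ toℕ (d (v , v∈P))
    colour≡ v v∈P with v ∈? P
    ... | yes v∈P′ = cong (λ p → toℕ (d (v , p))) ([]=-irrelevant v∈P′ v∈P)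
    ... | no  v∉P  = contradiction v∈P v∉P

    colour< : 0 < s → ∀ v → colour v < s
    colour< 0<s v with v ∈? P
    ... | yes v∈P = Fin.toℕ<n (d (v , v∈P))
    ... | no  _   = 0<s

    -- A vertex outside `P` takes the first colour of its class's pair, or the second if a neighbour
    -- in `P` has the first; by `avoid` the two are never both blocked. Adjacent vertices outside
    -- `P` lie in different classes, whose pairs are disjoint.
    extend : IsPrecoloring G P d →
      ∀ {B : Set} {M} (c : Fin n → B) → IsProper G c → (pair : B → ℕ × ℕ) → s ≤ M →
      (∀ i {x} → x ∈ₚ pair i → x < M) →
      (∀ i j {x} → x ∈ₚ pair i → x ∈ₚ pair j → i ≡ j) →
      (∀ v {y z} → y ∈ P → z ∈ P → Adj G v y → Adj G v z →
        colour y ≡ proj₁ (pair (c v)) → colour z ≡ proj₂ (pair (c v)) → ⊥) →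
      ExtendsToColoring G P d M
    extend proper {M = M} c c-proper pair s≤M small disjoint avoid = f , f-proper , f-extends
      where
      data Choice (v : Fin n) (x : ℕ) : Set where
        fixed : (v∈P : v ∈ P) → x ≡ toℕ (d (v , v∈P)) → Choice v x
        free  : v ∉ P → x ∈ₚ pair (c v) → (∀ {y} → y ∈ P → Adj G v y → colour y ≢ x) → Choice v x

      choice : ∀ v → ∃ λ x → x < M × Choice v x
      choice v with v ∈? P
      ... | yes v∈P = toℕ (d (v , v∈P)) , <-≤-trans (Fin.toℕ<n _) s≤M , fixed v∈P ≡.refl
      ... | no  v∉P
        with Fin.any? (λ y → y ∈? P ×-dec Adj? G v y ×-dec colour y ≟ proj₁ (pair (c v)))
      ...   | no  ¬a = proj₁ (pair (c v)) , small (c v) (inj₁ ≡.refl) ,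
        free v∉P (inj₁ ≡.refl) (λ y∈P vy eq → ¬a (_ , y∈P , vy , eq))
      ...   | yes (_ , y∈P , vy , eq) = proj₂ (pair (c v)) , small (c v) (inj₂ ≡.refl) ,
        free v∉P (inj₂ ≡.refl) (λ z∈P vz → avoid v y∈P z∈P vy vz eq)

      f : Fin n → Fin M
      f v = fromℕ< (proj₁ (proj₂ (choice v)))

      f-choice : ∀ v → Choice v (toℕ (f v))
      f-choice v with choice v
      ... | x , x<M , ch = subst (Choice v) (≡.sym (Fin.toℕ-fromℕ< x<M)) ch

      separate : ∀ {u v x} → Adj G u v → Choice u x → Choice v x → ⊥
      separate uv (fixed u∈P p) (fixed v∈P q) =
        proper _ _ uv (Fin.toℕ-injective (≡.trans (≡.sym p) q))
      separate uv (fixed u∈P p) (free _ _ ok) =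
        ok u∈P (Graph.sym G uv) (≡.trans (colour≡ _ u∈P) (≡.sym p))
      separate uv (free _ _ ok) (fixed v∈P q) =
        ok v∈P uv (≡.trans (colour≡ _ v∈P) (≡.sym q))
      separate uv (free _ p _)  (free _ q _)  = c-proper _ _ uv (disjoint _ _ p q)

      f-proper : IsColoring M G f
      f-proper u v uv eq = separate uv (f-choice u)
        (subst (Choice v) (≡.sym (cong toℕ eq)) (f-choice v))

      f-extends : Extends P d f
      f-extends v v∈P with f-choice v
      ... | fixed v∈P′ p = ≡.trans p (cong (λ q → toℕ (d (v , q))) ([]=-irrelevant v∈P′ v∈P))
      ... | free v∉P _ _ = contradiction v∈P v∉P

    module ConflictMatching (E : List (Fin n × Fin n)) (covers : Covers E) where

      conflicts : List (ℕ × ℕ)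
      conflicts = map (λ (x , y) → colour x , colour y) E

      open Matching (multiplicity conflicts) (multiplicity-sym conflicts) public

      joinsᴱ : ℕ → ℕ → Fin n × Fin n → ℕ
      joinsᴱ a b (x , y) = joins (colour x , colour y) a b

      multiplicity-∑ : ∀ a b → multiplicity conflicts a b ≡ ∑ (joinsᴱ a b) E
      multiplicity-∑ a b = helper E
        where
        helper : ∀ F → multiplicity (map (λ (x , y) → colour x , colour y) F) a b ≡ ∑ (joinsᴱ a b) F
        helper []      = ≡.refl
        helper (e ∷ F) = cong (joinsᴱ a b e +_) (helper F)

      conflict : ∀ {a b y z} → a ≢ b → colour y ≡ a → colour z ≡ b →
        y ∈ P → z ∈ P → CommonNeighbour y z →
        ∃ λ e → e ∈ˡ E × (e ≡ (y , z) ⊎ e ≡ (z , y)) × 1 ≤ joinsᴱ a b e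
      conflict {y = y} {z} a≢b ≡.refl ≡.refl y∈P z∈P cn
        with covers y∈P z∈P (λ { ≡.refl → a≢b ≡.refl }) cn
      ... | inj₁ e∈ = (y , z) , e∈ , inj₁ ≡.refl ,
        ≤-trans (≤-reflexive (≡.sym (cong₂ _*_ (𝟙-refl (colour y)) (𝟙-refl (colour z))))) (m≤m+n _ _)
      ... | inj₂ e∈ = (z , y) , e∈ , inj₂ ≡.refl ,
        ≤-trans (≤-reflexive (≡.sym (cong₂ _*_ (𝟙-refl (colour z)) (𝟙-refl (colour y)))))
          (m≤n+m _ (𝟙 (colour z) (colour y) * 𝟙 (colour y) (colour z)))

      -- The class of an endpoint x of the only conflict works, since no
      -- neighbour of x lies in it.
      safe-class : ∀ {r} (c : Fin n → Fin (suc r)) → IsProper G c → ∀ a b → a ≢ b →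
        multiplicity conflicts a b ≤ 1 →
        ∃ λ i → ∀ v {y z} → c v ≡ i → y ∈ P → z ∈ P → Adj G v y → Adj G v z →
          colour y ≡ a → colour z ≡ b → ⊥
      safe-class c c-proper a b a≢b light
        with ∑≤1-pick (joinsᴱ a b) E (subst (_≤ 1) (multiplicity-∑ a b) light)
      -- Without conflicts every class is safe; `zero` is an arbitrary choice.
      ... | inj₁ E≡[] = zero , λ v _ y∈P z∈P vy vz p q →
        absurd E≡[] (proj₁ (proj₂ (conflict a≢b p q y∈P z∈P (v , vy , vz))))
        where
        absurd : ∀ {e F} → F ≡ [] → e ∈ˡ F → ⊥
        absurd ≡.refl ()
      ... | inj₂ ((x , x′) , E′ , σ , none) = c x , safe
        where
        safe : ∀ v {y z} → c v ≡ c x → y ∈ P → z ∈ P → Adj G v y → Adj G v z →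
          colour y ≡ a → colour z ≡ b → ⊥
        safe v cv≡cx y∈P z∈P vy vz p q with conflict a≢b p q y∈P z∈P (v , vy , vz)
        ... | e , e∈ , e≡ , 1≤ with ∈-resp-↭ σ e∈
        ...   | there e∈′ = contradiction (≤-trans 1≤ (∑-≥-member _ e∈′)) (<⇒≱ (s≤s (≤-reflexive none)))
        safe v cv≡cx y∈P z∈P vy vz p q | e , e∈ , inj₁ ≡.refl , 1≤ | here ≡.refl = c-proper _ _ vy cv≡cx
        safe v cv≡cx y∈P z∈P vy vz p q | e , e∈ , inj₂ ≡.refl , 1≤ | here ≡.refl = c-proper _ _ vz cv≡cx

      -- The `suc m` pairs go to as many classes and every other class gets one fresh colour, which
      -- makes `2 (suc m) + (suc r - suc m)` colours. At most one pair has positive weight, and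
      -- `safe-class` finds a class for it.
      matching⇒extension : IsPrecoloring G P d → ∀ {r m} (c : Fin n → Fin (suc r)) → IsProper G c →
        suc m ≤ suc r → s ≤ suc m * 2 →
        ∀ ps → flatten ps ↭ upTo (suc m * 2) → cost ps ≤ 1 →
        ExtendsToColoring G P d (suc m + suc r)
      matching⇒extension proper {r} {m} c c-proper m≤r s≤2m ps σ light
        with ∑≤1-pick (λ (a , b) → multiplicity conflicts a b) ps light
      ... | inj₁ ≡.refl = contradiction (↭-length σ) λ ()
      ... | inj₂ ((a , b) , ps′ , τ , none) =
        extend proper c c-proper pair (≤-trans s≤2m 2m≤M) small disjoint avoid
        where
        open ≤-Reasoning
        qs : List (ℕ × ℕ)
        qs = (a , b) ∷ ps′
        σ′ : flatten qs ↭ upTo (suc m * 2)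
        σ′ = trans (↭-sym (flatten-↭ τ)) σ
        unique : Unique (flatten qs)
        unique = AllPairs-resp-↭ ≢-sym (↭-sym σ′) (upTo⁺ (suc m * 2))
        below : All (_< suc m * 2) (flatten qs)
        below = All-resp-↭ (↭-sym σ′) (All.all-upTo (suc m * 2))
        double : ∀ m → m * 2 ≡ m + m
        double = solve-∀
        2m≤M : suc m * 2 ≤ suc m + suc r
        2m≤M = ≤-trans (≤-reflexive (double (suc m))) (+-monoʳ-≤ (suc m) m≤r)
        length-qs : length qs ≡ suc m
        length-qs = *-cancelʳ-≡ _ _ 2 (≡.trans (≡.sym (length-flatten qs))
          (≡.trans (↭-length σ′) (length-upTo (suc m * 2))))
        a≢b : a ≢ b
        a≢b = flatten-≢ unique (here ≡.refl)
        light-ab : multiplicity conflicts a b ≤ 1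
        light-ab = m+n≤o⇒m≤o _ (subst (_≤ 1) (∑-↭ _ τ) light)
        i₀ : Fin (suc r)
        i₀ = proj₁ (safe-class c c-proper a b a≢b light-ab)
        -- The transposition moves the safe class `i₀` to slot 0, which holds `(a , b)`; all other
        -- slots hold pairs of weight 0 or fresh colours.
        slot : Fin (suc r) → Fin (suc r)
        slot = transpose i₀ zero ⟨$⟩ʳ_
        slot-injective : ∀ {i j} → slot i ≡ slot j → i ≡ j
        slot-injective eq = ≡.trans (≡.sym (transpose-inverse zero i₀))
          (≡.trans (cong (transpose zero i₀ ⟨$⟩ʳ_) eq) (transpose-inverse zero i₀))
        slot-i₀ : slot i₀ ≡ zero
        slot-i₀ with i₀ Fin.≟ i₀
        ... | yes _ = ≡.refl
        ... | no i₀≢i₀ = contradiction ≡.refl i₀≢i₀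
        pair : Fin (suc r) → ℕ × ℕ
        pair i = unit qs (suc m * 2) (toℕ (slot i))
        small : ∀ i {x} → x ∈ₚ pair i → x < suc m + suc r
        small i {x} x∈ = +-cancelˡ-< (suc m) x (suc m + suc r) (begin-strict
          suc m + x
            ≡⟨ cong (_+ x) length-qs ⟨
          length qs + x
            <⟨ unit-bound {qs} below (subst (_≤ suc r) (≡.sym length-qs) m≤r) (Fin.toℕ<n (slot i)) x∈ ⟩
          suc m * 2 + suc r
            ≡⟨ cong (_+ suc r) (double (suc m)) ⟩
          suc m + suc m + suc r
            ≡⟨ +-assoc (suc m) (suc m) (suc r) ⟩
          suc m + (suc m + suc r) ∎)
        disjoint : ∀ i j {x} → x ∈ₚ pair i → x ∈ₚ pair j → i ≡ j
        disjoint i j p q = slot-injective (Fin.toℕ-injective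
          (unit-disjoint {qs} unique below (toℕ (slot i)) (toℕ (slot j)) p q))
        avoid-at : ∀ v {y z} j → slot (c v) ≡ j → y ∈ P → z ∈ P → Adj G v y → Adj G v z →
          colour y ≡ proj₁ (unit qs (suc m * 2) (toℕ j)) →
          colour z ≡ proj₂ (unit qs (suc m * 2) (toℕ j)) → ⊥
        avoid-at v zero eq y∈P z∈P vy vz p q =
          proj₂ (safe-class c c-proper a b a≢b light-ab) v
            (slot-injective (≡.trans eq (≡.sym slot-i₀))) y∈P z∈P vy vz p q
        avoid-at v {y} {z} (suc j) eq y∈P z∈P vy vz p q with unit-∈ ps′ (suc m * 2) (toℕ j)
        -- A fresh colour is at least `suc m * 2 ≥ s`, hence absent from `P`. In the other case a
        -- conflict would give positive weight to a pair of `ps′`.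
        ... | inj₂ 2m≤ = <⇒≱
          (<-≤-trans (subst (_< s) (≡.sym (colour≡ y y∈P)) (Fin.toℕ<n (d (y , y∈P)))) s≤2m)
          (subst (suc m * 2 ≤_) (≡.sym p) 2m≤)
        ... | inj₁ ab∈ with conflict (flatten-≢ unique (there ab∈)) p q y∈P z∈P (v , vy , vz)
        ...   | e , e∈ , _ , 1≤ = <⇒≱ (s≤s (≤-reflexive none)) (≤-trans 1≤
          (≤-trans (∑-≥-member _ e∈) (≤-trans (≤-reflexive (≡.sym (multiplicity-∑ _ _)))
            (∑-≥-member (λ (a , b) → multiplicity conflicts a b) ab∈))))
        avoid : ∀ v {y z} → y ∈ P → z ∈ P → Adj G v y → Adj G v z →
          colour y ≡ proj₁ (pair (c v)) → colour z ≡ proj₂ (pair (c v)) → ⊥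
        avoid v = avoid-at v (slot (c v)) ≡.refl

-- The two parities of `r + k`

theorem5 : (k r : ℕ) → k ≥ 1 → r ≥ 2 → k ≤ r →
    (n : ℕ) (G : Graph (Fin n)) →
    (χ : ℕ) → IsChromaticNumber G χ → χ ≤ r →
    (P : Subset n) (d : ∃ (_∈ P) → Fin (r + k)) → IsPrecoloring G P d →
    (δ : ℕ) → HasCardinality (𝒟 G P 2) δ →
    ((r + k) % 2 ≡ 0 → δ < 2 * (r + k ∸ 1) →
    ExtendsToColoring G P d ((3 * r + k) / 2))
    ×
    ((r + k) % 2 ≡ 1 → r + k ≥ 13 → δ < 3 * (r + k ∸ 1) →
    ExtendsToColoring G P d ((3 * r + k + 1) / 2))
theorem5 k r@(suc r′) _ _ k≤r n G χ ((c₀ , c₀-proper) , _) χ≤r P d proper δ card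
  with cardinality⇒covers G P card
... | E , lenE , covers = even , odd
  where
  s : ℕ
  s = r + k

  c : Fin n → Fin r
  c v = inject≤ (c₀ v) χ≤r

  c-proper : IsProper G c
  c-proper u v uv eq = c₀-proper u v uv (Fin.inject≤-injective χ≤r χ≤r _ _ eq)

  open ConflictMatching G P d E covers

  -- Here `x` is the number of colours added to make `s` even, and `m` is the resulting number of
  -- pairs.
  palette : ∀ m x → s + x ≡ m * 2 → (3 * r + k + x) / 2 ≡ m + r
  palette m x eq = ≡.trans (cong (_/ 2) (≡.trans (regroup r k x)
    (≡.trans (cong (r * 2 +_) eq) (collect r m)))) (m*n/n≡m (m + r) 2)
    where
    regroup : ∀ r k x → 3 * r + k + x ≡ r * 2 + (r + k + x)
    regroup = solve-∀
    collect : ∀ r m → r * 2 + m * 2 ≡ (m + r) * 2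
    collect = solve-∀

  s≤2r : s ≤ r * 2
  s≤2r = ≤-trans (+-monoʳ-≤ r k≤r) (≤-reflexive (double r))
    where
    double : ∀ r → r + r ≡ r * 2
    double = solve-∀

  weight-upTo : weight (upTo s) ≤ δ
  weight-upTo = ≤-trans (pairSum-multiplicity conflicts (upTo⁺ s))
    (≤-reflexive (≡.trans (length-map _ E) lenE))

  light : ∀ {t} → δ < t * (s ∸ 1) → weight (upTo s) < t * (length (upTo s) ∸ 1)
  light {t} δ< = ≤-<-trans weight-upTo
    (subst (λ l → δ < t * (l ∸ 1)) (≡.sym (length-upTo s)) δ<)

  even : s % 2 ≡ 0 → δ < 2 * (s ∸ 1) → ExtendsToColoring G P d ((3 * r + k) / 2)
  even s%2≡0 δ< = subst (ExtendsToColoring G P d)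
    (≡.trans (≡.sym (palette (s / 2) 0 (≡.trans (+-identityʳ s) s≡)))
      (cong (_/ 2) (+-identityʳ (3 * r + k))))
    (go (s / 2) s≡)
    where
    s≡ : s ≡ (s / 2) * 2
    s≡ = ≡.trans (m≡m%n+[m/n]*n s 2) (cong (_+ (s / 2) * 2) s%2≡0)

    go : ∀ m → s ≡ m * 2 → ExtendsToColoring G P d (m + r)
    go (suc m) s≡
      with light-perfect-matching (upTo s) m (≡.trans (length-upTo s) s≡) (light {2} δ<)
    ... | ps , σ , light-cost = matching⇒extension proper c c-proper
      (*-cancelʳ-≤ (suc m) r 2 (subst (_≤ r * 2) s≡ s≤2r)) (≤-reflexive s≡)
      ps (subst (λ t → flatten ps ↭ upTo t) s≡ σ) light-cost

  odd : s % 2 ≡ 1 → s ≥ 13 → δ < 3 * (s ∸ 1) → ExtendsToColoring G P d ((3 * r + k + 1) / 2)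
  odd s%2≡1 s≥13 δ< = subst (ExtendsToColoring G P d)
    (≡.sym (palette (suc (s / 2)) 1 (≡.trans (+-comm s 1) (cong suc s≡))))
    (go (s / 2) s≡)
    where
    s≡ : s ≡ suc ((s / 2) * 2)
    s≡ = ≡.trans (m≡m%n+[m/n]*n s 2) (cong (_+ (s / 2) * 2) s%2≡1)

    -- The added colour is `s`, the first one beyond the palette of `d`. The junk value 0 also
    -- differs from it, as `s` is positive.
    fresh : ∀ x → colour G P d x ≢ s
    fresh x = <⇒≢ (colour< G P d (s≤s z≤n) x)

    -- Pairing the leftover colour `l` with the added one is therefore free.
    unused : ∀ l → multiplicity conflicts l s ≡ 0
    unused l = ∑-0 _ (All.map⁺ (All.universal (λ (x , y) → joins-≢ l (fresh x) (fresh y)) E))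

    go : ∀ m → s ≡ suc (m * 2) → ExtendsToColoring G P d (suc m + r)
    go m s≡ with light-near-perfect-matching (upTo s) m
      (≡.trans (length-upTo s) (≡.trans s≡ (+-comm 1 (m * 2))))
      (subst (13 ≤_) (≡.sym (length-upTo s)) s≥13) (light {3} δ<)
    ... | ps , l , σ , light-cost = matching⇒extension proper c c-proper
      -- From `2m + 1 ≤ 2r` follows `m < r`, which leaves a class for the extra pair `(l , s)`.
      (*-cancelʳ-< 2 m r (subst (_≤ r * 2) s≡ s≤2r))
      (≤-trans (n≤1+n s) (≤-reflexive (cong suc s≡)))
      ((l , s) ∷ ps) (subst (λ t → flatten ((l , s) ∷ ps) ↭ upTo t) (cong suc s≡) σ′)
      (≤-trans (≤-reflexive (cong (_+ cost ps) (unused l))) light-cost)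
      where
      σ′ : flatten ((l , s) ∷ ps) ↭ upTo (suc s)
      σ′ = trans (swap l s refl) (trans (prep s (trans (∷↭∷ʳ l (flatten ps)) σ))
        (trans (∷↭∷ʳ s (upTo s)) (↭-reflexive (upTo-∷ʳ s))))
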